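{- If $G$ is a connected graph and $n\ge 1$ is an integer, then $$\dim(G)\le \dim_{n\ell}(G\odot K_n)\le n(G).$$
   Context: Graphs are finite, simple and connected; $d(u,v)$ is the shortest-path distance and $n(G)$ the number of vertices. A set $X$ of vertices resolves two vertices $u,v$ if some $x\in X$ satisfies $d(u,x)\neq d(v,x)$. $X$ is a resolving set if it resolves every pair of distinct vertices; the metric dimension $\dim(G)$ is the minimum size of a resolving set. $X$ is a nonlocal resolving set if it resolves every pair of distinct non-adjacent vertices; the nonlocal metric dimension $\dim_{n\ell}$ is the minimum size of a nonlocal resolving set. For $V(G)=\{g_1,\dots,g_{n(G)}\}$, the corona product $G\odot H$ is obtained from the disjoint union of $G$ and $n(G)$ copies $H_1,\dots,H_{n(G)}$ of $H$ by joining $g_i$ to every vertex of $H_i$ for each $i$. -}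

module Defs where

open import Data.Nat using (ℕ; zero; suc; _+_; _*_; _≤_; z≤n; s≤s)
import Data.Nat.Properties as ℕ
open import Data.Fin using (Fin)
import Data.Fin.Properties as Fin
open import Data.Fin.Subset using (Subset; _∈_; ∣_∣; ⊤)
open import Data.Fin.Subset.Properties using (_∈?_; anySubset?; ∈⊤)
open import Data.Product using (∃; ∃-syntax; _×_; _,_; proj₁; proj₂)
open import Data.Product.Function.NonDependent.Propositional using (_×-↔_)
open import Data.Sum using (_⊎_; inj₁; inj₂)
open import Data.Sum.Function.Propositional using (_⊎-↔_)
open import Function using (_∘_)
open import Function.Bundles using (_↔_; Inverse)
open import Function.Construct.Composition using (_↔-∘_)
open import Function.Construct.Identity using (↔-id)
open import Function.Construct.Symmetry using (↔-sym)
open import Function.Properties.Inverse using (Inverse⇒Injection)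
open import Relation.Binary.Definitions as B using (DecidableEquality)
open import Relation.Binary.PropositionalEquality using (_≡_; _≢_; refl; sym; subst)
open import Relation.Nullary using (¬_; Dec; yes; no; contradiction)
open import Relation.Nullary.Decidable using (map′; _×-dec_; _→-dec_; ¬?; via-injection)
open import Relation.Unary using (Decidable)

IsLeast : (ℕ → Set) → ℕ → Set
IsLeast P k = P k × (∀ j → P j → k ≤ j)

least : {P : ℕ → Set} → Decidable P → ∃ P → ∃ (IsLeast P)
least P? (n , p) = search P? n p
  where
  search : {P : ℕ → Set} → Decidable P → ∀ n → P n → ∃ (IsLeast P)
  search P? n p with P? 0
  ... | yes p₀ = 0 , p₀ , λ _ _ → z≤n
  search P? zero    p | no ¬p₀ = contradiction p ¬p₀
  search P? (suc n) p | no ¬p₀ with search (P? ∘ suc) n p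
  ... | k , pk , k-min = suc k , pk , λ where
    zero    q → contradiction q ¬p₀
    (suc j) q → s≤s (k-min j q)

-- Finite simple graphs.  Finiteness is an explicit enumeration of V; no
-- definition below depends, up to provable equality, on which one is chosen.
record Graph : Set₁ where
  infix 4 _~_ _~?_
  field
    V        : Set
    order    : ℕ
    V↔Fin    : V ↔ Fin order
    _~_      : V → V → Set
    _~?_     : B.Decidable _~_
    ~-sym    : ∀ {u v} → u ~ v → v ~ u
    ~-irrefl : ∀ {v} → ¬ (v ~ v)

  index : V → Fin order
  index = Inverse.to V↔Fin

  vertex : Fin order → V
  vertex = Inverse.from V↔Fin

  infix 4 _≟_
  _≟_ : DecidableEquality V
  _≟_ = via-injection (Inverse⇒Injection V↔Fin) Fin._≟_

  vertex-index : ∀ v → vertex (index v) ≡ v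
  vertex-index = Inverse.strictlyInverseʳ V↔Fin

  anyV? : {P : V → Set} → Decidable P → Dec (∃ P)
  anyV? {P} P? = map′ (λ (i , p) → vertex i , p)
                      (λ (v , p) → index v , subst P (sym (vertex-index v)) p)
                      (Fin.any? (P? ∘ vertex))

  allV? : {P : V → Set} → Decidable P → Dec (∀ v → P v)
  allV? {P} P? = map′ (λ f v → subst P (vertex-index v) (f (index v)))
                      (λ f → f ∘ vertex)
                      (Fin.all? (P? ∘ vertex))

module _ (G : Graph) where
  open Graph G

  -- Walk u v k: a walk with k edges from u to v.
  data Walk : V → V → ℕ → Set where
    []  : ∀ {v} → Walk v v 0
    _∷_ : ∀ {u w v k} → u ~ w → Walk w v k → Walk u v (suc k)

  Connected : Set
  Connected = ∀ u v → ∃[ k ] Walk u v k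

  walk? : ∀ u v → Decidable (Walk u v)
  walk? u v zero    = map′ (λ { refl → [] }) (λ { [] → refl }) (u ≟ v)
  walk? u v (suc k) = map′ (λ { (_ , e , p) → e ∷ p }) (λ { (e ∷ p) → _ , e , p })
                           (anyV? (λ w → (u ~? w) ×-dec walk? w v k))

module _ (G : Graph) (conn : Connected G) where
  open Graph G

  -- A shortest walk is a path, so the least walk length is the
  -- shortest-path distance.
  dist-least : ∀ u v → ∃ (IsLeast (Walk G u v))
  dist-least u v = least (walk? G u v) (conn u v)

  dist : V → V → ℕ
  dist u v = proj₁ (dist-least u v)

  -- A vertex set is a Subset of the index set; x belongs to X iff index x ∈ X.
  Resolves : Subset order → V → V → Set
  Resolves X u v = ∃[ x ] index x ∈ X × dist u x ≢ dist v x

  IsResolving : Subset order → Set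
  IsResolving X = ∀ u v → u ≢ v → Resolves X u v

  IsNonlocalResolving : Subset order → Set
  IsNonlocalResolving X = ∀ u v → u ≢ v → ¬ (u ~ v) → Resolves X u v

  resolves? : ∀ X u v → Dec (Resolves X u v)
  resolves? X u v = anyV? λ x → (index x ∈? X) ×-dec ¬? (dist u x ℕ.≟ dist v x)

  isResolving? : Decidable IsResolving
  isResolving? X = allV? λ u → allV? λ v → ¬? (u ≟ v) →-dec resolves? X u v

  isNonlocalResolving? : Decidable IsNonlocalResolving
  isNonlocalResolving? X =
    allV? λ u → allV? λ v → ¬? (u ≟ v) →-dec (¬? (u ~? v) →-dec resolves? X u v)

  dist-refl : ∀ v → dist v v ≡ 0
  dist-refl v = ℕ.n≤0⇒n≡0 (proj₂ (proj₂ (dist-least v v)) 0 [])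

  dist≡0⇒≡ : ∀ u v → dist u v ≡ 0 → u ≡ v
  dist≡0⇒≡ u v eq with subst (Walk G u v) eq (proj₁ (proj₂ (dist-least u v)))
  ... | [] = refl

  ⊤-isResolving : IsResolving ⊤
  ⊤-isResolving u v u≢v =
    u , ∈⊤ , λ eq → u≢v (sym (dist≡0⇒≡ v u (subst (_≡ 0) eq (dist-refl u))))

  HasSize : (Subset order → Set) → ℕ → Set
  HasSize P k = ∃[ X ] P X × ∣ X ∣ ≡ k

  hasSize? : {P : Subset order → Set} → Decidable P → Decidable (HasSize P)
  hasSize? P? k = anySubset? λ X → P? X ×-dec (∣ X ∣ ℕ.≟ k)

  dim-least : ∃ (IsLeast (HasSize IsResolving))
  dim-least = least (hasSize? isResolving?) (_ , ⊤ , ⊤-isResolving , refl)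

  dim : ℕ
  dim = proj₁ dim-least

  dimₙₗ-least : ∃ (IsLeast (HasSize IsNonlocalResolving))
  dimₙₗ-least = least (hasSize? isNonlocalResolving?)
                      (_ , ⊤ , (λ u v u≢v _ → ⊤-isResolving u v u≢v) , refl)

  dimₙₗ : ℕ
  dimₙₗ = proj₁ dimₙₗ-least

K : ℕ → Graph
K n = record
  { V        = Fin n
  ; order    = n
  ; V↔Fin    = ↔-id (Fin n)
  ; _~_      = _≢_
  ; _~?_     = λ u v → ¬? (u Fin.≟ v)
  ; ~-sym    = λ u≢v v≡u → u≢v (sym v≡u)
  ; ~-irrefl = λ v≢v → v≢v refl
  }

module _ (G H : Graph) where
  private
    module G = Graph G
    module H = Graph H

  -- inj₁ g is the vertex g of G; inj₂ (g , h) is the vertex h of the copy of H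
  -- attached to g.
  CoronaV : Set
  CoronaV = G.V ⊎ (G.V × H.V)

  data CoronaAdj : CoronaV → CoronaV → Set where
    base  : ∀ {g g′} → g G.~ g′ → CoronaAdj (inj₁ g) (inj₁ g′)
    copy  : ∀ {g h h′} → h H.~ h′ → CoronaAdj (inj₂ (g , h)) (inj₂ (g , h′))
    join  : ∀ {g h} → CoronaAdj (inj₁ g) (inj₂ (g , h))
    join′ : ∀ {g h} → CoronaAdj (inj₂ (g , h)) (inj₁ g)

  coronaAdj? : B.Decidable CoronaAdj
  coronaAdj? (inj₁ g) (inj₁ g′) = map′ base (λ { (base e) → e }) (g G.~? g′)
  coronaAdj? (inj₁ g) (inj₂ (g′ , h)) =
    map′ (λ { refl → join }) (λ { join → refl }) (g G.≟ g′)
  coronaAdj? (inj₂ (g , h)) (inj₁ g′) =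
    map′ (λ { refl → join′ }) (λ { join′ → refl }) (g G.≟ g′)
  coronaAdj? (inj₂ (g , h)) (inj₂ (g′ , h′)) =
    map′ (λ { (refl , e) → copy e }) (λ { (copy e) → refl , e })
         ((g G.≟ g′) ×-dec (h H.~? h′))

  coronaAdj-sym : ∀ {u v} → CoronaAdj u v → CoronaAdj v u
  coronaAdj-sym (base e) = base (G.~-sym e)
  coronaAdj-sym (copy e) = copy (H.~-sym e)
  coronaAdj-sym join     = join′
  coronaAdj-sym join′    = join

  coronaAdj-irrefl : ∀ {v} → ¬ CoronaAdj v v
  coronaAdj-irrefl (base e) = G.~-irrefl e
  coronaAdj-irrefl (copy e) = H.~-irrefl e

  infixl 7 _⊙_
  _⊙_ : Graph
  _⊙_ = record
    { V        = CoronaV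
    ; order    = G.order + G.order * H.order
    ; V↔Fin    = ↔-sym Fin.+↔⊎
                   ↔-∘ (G.V↔Fin ⊎-↔ (↔-sym Fin.*↔× ↔-∘ (G.V↔Fin ×-↔ H.V↔Fin)))
    ; _~_      = CoronaAdj
    ; _~?_     = coronaAdj?
    ; ~-sym    = coronaAdj-sym
    ; ~-irrefl = coronaAdj-irrefl
    }

  ⊙-connected : Connected G → Connected _⊙_
  ⊙-connected conn = λ where
      (inj₁ g)       v → fromBase g v
      (inj₂ (g , h)) v → let k , p = fromBase g v in suc k , join′ ∷ p
    where
    extend : ∀ {g g′ v k l} → Walk G g g′ k → Walk _⊙_ (inj₁ g′) v l →
             Walk _⊙_ (inj₁ g) v (k + l)
    extend []      q = q
    extend (e ∷ p) q = base e ∷ extend p q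

    fromBase : ∀ g v → ∃[ k ] Walk _⊙_ (inj₁ g) v k
    fromBase g (inj₁ g′)       = _ , extend (proj₂ (conn g g′)) []
    fromBase g (inj₂ (g′ , h)) = _ , extend (proj₂ (conn g g′)) (join ∷ [])

{-# OPTIONS --safe #-}
-- Let π : G ⊙ Kₙ → G send every copy of Kₙ to the vertex it hangs from.
--
-- Lower bound: if X is a nonlocal resolving set of G ⊙ Kₙ, then π(X) resolves G.
-- For u ≠ v choose h in Kₙ; the copies (u , h) and (v , h) are not adjacent, so
-- some x in X resolves them.  If π x is u or v, then π x trivially resolves u
-- and v.  Otherwise both distances to x exceed the distances in G to π x by the
-- same amount, so again π x resolves u and v.
--
-- Upper bound: V(G) is a nonlocal resolving set of G ⊙ Kₙ, because a vertex of a
-- copy is at distance 1 from exactly one vertex of G, and vertices of the same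
-- copy are adjacent.
module Submission where

open import Defs
open import Data.Fin using (Fin; zero; suc; fromℕ<)
open import Data.Fin.Subset using (Subset; inside; outside; _∈_; ∣_∣; ⊤; ⊥; ⁅_⁆; _∪_)
open import Data.Fin.Subset.Properties using (∈⊤; ∣⊤∣≡n; ∣⊥∣≡0; ∣⁅x⁆∣≡1; x∈⁅x⁆; p⊆p∪q; q⊆p∪q)
open import Data.Nat using (ℕ; suc; _+_; _≤_; z≤n; s≤s)
import Data.Nat.Properties as ℕ
open import Data.Product using (∃-syntax; _×_; _,_; proj₁; proj₂)
open import Data.Sum using (inj₁; inj₂)
open import Data.Vec using ([]; _∷_; here; there)
open import Function using (_∘_)
open import Relation.Binary.PropositionalEquality using (_≡_; _≢_; refl; sym; trans; cong; subst)
open import Relation.Nullary using (¬_; Dec; yes; no; contradiction)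

∣p∪q∣≤∣p∣+∣q∣ : ∀ {n} (p q : Subset n) → ∣ p ∪ q ∣ ≤ ∣ p ∣ + ∣ q ∣
∣p∪q∣≤∣p∣+∣q∣ []            []            = z≤n
∣p∪q∣≤∣p∣+∣q∣ (outside ∷ p) (outside ∷ q) = ∣p∪q∣≤∣p∣+∣q∣ p q
∣p∪q∣≤∣p∣+∣q∣ (outside ∷ p) (inside  ∷ q) =
  ℕ.≤-trans (s≤s (∣p∪q∣≤∣p∣+∣q∣ p q)) (ℕ.≤-reflexive (sym (ℕ.+-suc ∣ p ∣ ∣ q ∣)))
∣p∪q∣≤∣p∣+∣q∣ (inside  ∷ p) (outside ∷ q) = s≤s (∣p∪q∣≤∣p∣+∣q∣ p q)
∣p∪q∣≤∣p∣+∣q∣ (inside  ∷ p) (inside  ∷ q) =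
  s≤s (ℕ.≤-trans (∣p∪q∣≤∣p∣+∣q∣ p q) (ℕ.+-monoʳ-≤ ∣ p ∣ (ℕ.n≤1+n ∣ q ∣)))

image : ∀ {m n} → (Fin m → Fin n) → Subset m → Subset n
image f []            = ⊥
image f (outside ∷ p) = image (f ∘ suc) p
image f (inside  ∷ p) = ⁅ f zero ⁆ ∪ image (f ∘ suc) p

∈-image : ∀ {m n} (f : Fin m → Fin n) {p : Subset m} {i} → i ∈ p → f i ∈ image f p
∈-image f {inside  ∷ p} here        = p⊆p∪q (image (f ∘ suc) p) (x∈⁅x⁆ (f zero))
∈-image f {inside  ∷ p} (there i∈p) =
  q⊆p∪q ⁅ f zero ⁆ (image (f ∘ suc) p) (∈-image (f ∘ suc) i∈p)
∈-image f {outside ∷ p} (there i∈p) = ∈-image (f ∘ suc) i∈p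

∣image∣≤ : ∀ {m n} (f : Fin m → Fin n) (p : Subset m) → ∣ image f p ∣ ≤ ∣ p ∣
∣image∣≤ {n = n} f [] = ℕ.≤-reflexive (∣⊥∣≡0 n)
∣image∣≤ f (outside ∷ p) = ∣image∣≤ (f ∘ suc) p
∣image∣≤ f (inside  ∷ p) =
  ℕ.≤-trans (∣p∪q∣≤∣p∣+∣q∣ ⁅ f zero ⁆ (image (f ∘ suc) p))
            (ℕ.+-mono-≤ (ℕ.≤-reflexive (∣⁅x⁆∣≡1 (f zero))) (∣image∣≤ (f ∘ suc) p))

module _ (G : Graph) (conn : Connected G) where
  open Graph G

  dist-walk : ∀ u v → Walk G u v (dist G conn u v)
  dist-walk u v = proj₁ (proj₂ (dist-least G conn u v))

  dist-min : ∀ {u v k} → Walk G u v k → dist G conn u v ≤ k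
  dist-min {u} {v} p = proj₂ (proj₂ (dist-least G conn u v)) _ p

  dist≡1⇒~ : ∀ u v → dist G conn u v ≡ 1 → u ~ v
  dist≡1⇒~ u v eq with subst (Walk G u v) eq (dist-walk u v)
  ... | e ∷ [] = e

  ~⇒dist≡1 : ∀ u v → u ~ v → dist G conn u v ≡ 1
  ~⇒dist≡1 u v e = ℕ.≤-antisym (dist-min (e ∷ [])) (ℕ.n≢0⇒n>0 d≢0)
    where
    d≢0 : dist G conn u v ≢ 0
    d≢0 eq = ~-irrefl (subst (_~ v) (dist≡0⇒≡ G conn u v eq) e)

  self-resolves : ∀ u v → u ≢ v → dist G conn u u ≢ dist G conn v u
  self-resolves u v u≢v eq =
    u≢v (sym (dist≡0⇒≡ G conn v u (trans (sym eq) (dist-refl G conn u))))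

  dim-min : ∀ X → IsResolving G conn X → dim G conn ≤ ∣ X ∣
  dim-min X res = proj₂ (proj₂ (dim-least G conn)) ∣ X ∣ (X , res , refl)

  dimₙₗ-attained : HasSize G conn (IsNonlocalResolving G conn) (dimₙₗ G conn)
  dimₙₗ-attained = proj₁ (proj₂ (dimₙₗ-least G conn))

  dimₙₗ-min : ∀ X → IsNonlocalResolving G conn X → dimₙₗ G conn ≤ ∣ X ∣
  dimₙₗ-min X res = proj₂ (proj₂ (dimₙₗ-least G conn)) ∣ X ∣ (X , res , refl)

module Corona (G H : Graph) (conn : Connected G) (connᶜ : Connected (G ⊙ H)) where
  private
    module G = Graph G
    module H = Graph H
    module C = Graph (G ⊙ H)

  π : C.V → G.V
  π (inj₁ g)       = g
  π (inj₂ (g , _)) = g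

  -- The distance from `x` to its base vertex `π x`.
  height : C.V → ℕ
  height (inj₁ _) = 0
  height (inj₂ _) = 1

  height≤1 : ∀ x → height x ≤ 1
  height≤1 (inj₁ _) = z≤n
  height≤1 (inj₂ _) = s≤s z≤n

  lift-walk : ∀ {u k} x → Walk G u (π x) k → Walk (G ⊙ H) (inj₁ u) x (height x + k)
  lift-walk (inj₁ g)       []      = []
  lift-walk (inj₂ (g , h)) []      = join ∷ []
  lift-walk (inj₁ g)       (e ∷ p) = base e ∷ lift-walk (inj₁ g) p
  lift-walk (inj₂ (g , h)) (e ∷ p) = base e ∷ lift-walk (inj₂ (g , h)) p

  -- Detours into copies can be cut out: a copy is left only through the base vertex it hangs from,
  -- so the walk comes back to where it entered. Only the final entry into a copy containing `x`
  -- must be paid for, by `height x`.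
  project-walk-base : ∀ {u x l} → Walk (G ⊙ H) (inj₁ u) x l →
    ∃[ k ] Walk G u (π x) k × height x + k ≤ l
  -- Since `x` is neither `u` nor in the copy at `u`, the walk must use a `join′` edge to get out;
  -- this edge is the extra `suc`.
  project-walk-copy : ∀ {u h x l} → u ≢ π x → Walk (G ⊙ H) (inj₂ (u , h)) x l →
    ∃[ k ] Walk G u (π x) k × suc (height x + k) ≤ l

  project-walk-base []           = 0 , [] , z≤n
  project-walk-base {x = x} (base e ∷ p) with project-walk-base p
  ... | k , q , le = suc k , e ∷ q , ℕ.≤-trans (ℕ.≤-reflexive (ℕ.+-suc (height x) k)) (s≤s le)
  project-walk-base {u} {x} (join ∷ p) with u G.≟ π x
  -- The walk need not leave this copy again, but the `join` edge already taken covers `height x`,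
  -- which is at most 1.
  ... | yes refl = 0 , [] , ℕ.≤-trans (ℕ.≤-reflexive (ℕ.+-identityʳ (height x)))
                               (ℕ.≤-trans (height≤1 x) (s≤s z≤n))
  ... | no u≢πx with project-walk-copy u≢πx p
  ...   | k , q , le = k , q , ℕ.≤-trans (ℕ.<⇒≤ le) (ℕ.n≤1+n _)

  project-walk-copy u≢πx []           = contradiction refl u≢πx
  project-walk-copy u≢πx (copy _ ∷ p) with project-walk-copy u≢πx p
  ... | k , q , le = k , q , ℕ.m≤n⇒m≤1+n le
  project-walk-copy u≢πx (join′ ∷ p) with project-walk-base p
  ... | k , q , le = k , q , s≤s le

  -- One edge leaves the copy and `height x` edges reach `x` from `π x`. The excess over the
  -- distance in `G` depends on `x` alone, so it cancels when two such vertices are compared.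
  dist-copy : ∀ {u} h x → u ≢ π x →
    dist (G ⊙ H) connᶜ (inj₂ (u , h)) x ≡ suc (height x + dist G conn u (π x))
  dist-copy {u} h x u≢πx = ℕ.≤-antisym
      (dist-min (G ⊙ H) connᶜ (join′ ∷ lift-walk x (dist-walk G conn u (π x))))
      (lower (project-walk-copy u≢πx (dist-walk (G ⊙ H) connᶜ (inj₂ (u , h)) x)))
    where
    lower : ∀ {l} → ∃[ k ] Walk G u (π x) k × suc (height x + k) ≤ l →
            suc (height x + dist G conn u (π x)) ≤ l
    lower (k , q , le) =
      ℕ.≤-trans (s≤s (ℕ.+-monoʳ-≤ (height x) (dist-min G conn q))) le

  projection : Subset C.order → Subset G.order
  projection = image (G.index ∘ π ∘ C.vertex)

  ∈-projection : ∀ {X} x → C.index x ∈ X → G.index (π x) ∈ projection X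
  ∈-projection {X} x x∈X =
    subst (λ y → G.index (π y) ∈ projection X) (C.vertex-index x)
          (∈-image (G.index ∘ π ∘ C.vertex) x∈X)

  projection-isResolving : H.V → ∀ {X} → IsNonlocalResolving (G ⊙ H) connᶜ X →
    IsResolving G conn (projection X)
  projection-isResolving h {X} res u v u≢v
    -- A `copy` edge stays inside one copy, so `u ≢ v` rules out adjacency.
    with res (inj₂ (u , h)) (inj₂ (v , h)) (λ { refl → u≢v refl }) (λ { (copy _) → u≢v refl })
  ... | x , x∈X , d≢ = π x , ∈-projection x x∈X , resolves (u G.≟ π x) (v G.≟ π x)
    where
    resolves : Dec (u ≡ π x) → Dec (v ≡ π x) →
               dist G conn u (π x) ≢ dist G conn v (π x)
    resolves (yes refl) _           = self-resolves G conn u v u≢v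
    resolves (no _)     (yes refl)  = self-resolves G conn v u (u≢v ∘ sym) ∘ sym
    resolves (no u≢πx)  (no v≢πx)   = λ eq →
      d≢ (trans (dist-copy h x u≢πx)
         (trans (cong (λ d → suc (height x + d)) eq) (sym (dist-copy h x v≢πx))))

  dim≤dimₙₗ : H.V → dim G conn ≤ dimₙₗ (G ⊙ H) connᶜ
  dim≤dimₙₗ h =
    let X , res , ∣X∣≡dimₙₗ = dimₙₗ-attained (G ⊙ H) connᶜ in
    ℕ.≤-trans (dim-min G conn (projection X) (projection-isResolving h res))
    (ℕ.≤-trans (∣image∣≤ (G.index ∘ π ∘ C.vertex) X) (ℕ.≤-reflexive ∣X∣≡dimₙₗ))

  baseSet : Subset C.order
  baseSet = image (C.index ∘ inj₁ ∘ G.vertex) ⊤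

  ∈-baseSet : ∀ g → C.index (inj₁ g) ∈ baseSet
  ∈-baseSet g =
    subst (λ g′ → C.index (inj₁ g′) ∈ baseSet) (G.vertex-index g)
          (∈-image (C.index ∘ inj₁ ∘ G.vertex) {i = G.index g} ∈⊤)

  -- A base vertex is told apart from any other vertex by itself. For two copy vertices the base
  -- vertex of the first one serves.
  baseSet-isNonlocalResolving : (∀ h h′ → h ≢ h′ → h H.~ h′) →
    IsNonlocalResolving (G ⊙ H) connᶜ baseSet
  baseSet-isNonlocalResolving complete (inj₁ g) v u≢v _ =
    inj₁ g , ∈-baseSet g , self-resolves (G ⊙ H) connᶜ (inj₁ g) v u≢v
  baseSet-isNonlocalResolving complete u@(inj₂ _) (inj₁ g) u≢v _ =
    inj₁ g , ∈-baseSet g , self-resolves (G ⊙ H) connᶜ (inj₁ g) u (u≢v ∘ sym) ∘ sym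
  baseSet-isNonlocalResolving complete u@(inj₂ (g , h)) v@(inj₂ (g′ , h′)) u≢v u≁v =
    inj₁ g , ∈-baseSet g , λ eq →
      not-attached (dist≡1⇒~ (G ⊙ H) connᶜ v (inj₁ g)
        (trans (sym eq) (~⇒dist≡1 (G ⊙ H) connᶜ u (inj₁ g) join′)))
    where
    not-attached : ¬ (inj₂ (g′ , h′) C.~ inj₁ g)
    -- Matching `join′` identifies `g′` with `g`, so both vertices lie in one complete copy and are
    -- adjacent.
    not-attached join′ = u≁v (copy (complete h h′ (λ { refl → u≢v refl })))

  dimₙₗ≤order : (∀ h h′ → h ≢ h′ → h H.~ h′) → dimₙₗ (G ⊙ H) connᶜ ≤ G.order
  dimₙₗ≤order complete =
    ℕ.≤-trans (dimₙₗ-min (G ⊙ H) connᶜ baseSet (baseSet-isNonlocalResolving complete))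
    (ℕ.≤-trans (∣image∣≤ (C.index ∘ inj₁ ∘ G.vertex) ⊤) (ℕ.≤-reflexive (∣⊤∣≡n G.order)))

theorem3p3 : (G : Graph) (conn : Connected G) (n : ℕ) → 1 ≤ n →
    (dim G conn ≤ dimₙₗ (G ⊙ K n) (⊙-connected G (K n) conn))
    × (dimₙₗ (G ⊙ K n) (⊙-connected G (K n) conn) ≤ Graph.order G)
theorem3p3 G conn n 1≤n =
    -- `1≤n` supplies the vertex of `K n` whose copies are compared.
    Corona.dim≤dimₙₗ G (K n) conn (⊙-connected G (K n) conn) (fromℕ< 1≤n)
  , Corona.dimₙₗ≤order G (K n) conn (⊙-connected G (K n) conn) (λ _ _ h≢h′ → h≢h′)
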